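{- Let $\ell\ge 1$ and let $\{p_n(x)\}_{n\ge 0}$ be a sequence of polynomials satisfying $p_{n+\ell}(x)=\sum_{j=1}^{\ell}a_j(x)p_{n+\ell-j}(x)$ for $n\ge 0$, where $a_1(x),\dots,a_\ell(x)$ are fixed polynomials and $p_0(x),\dots,p_{\ell-1}(x)$ are prescribed. Let $$P(t,x)=\sum_{n\ge0}p_n(x)t^n=\frac{N(t,x)}{D(t,x)},$$ where $$D(t,x)=1-\sum_{j=1}^{\ell}a_j(x)t^j,\qquad N(t,x)=\sum_{m=0}^{\ell-1}\Bigl(p_m(x)-\sum_{j=1}^{m}a_j(x)p_{m-j}(x)\Bigr)t^m,$$ so that $D(0,x)=1$. Then the following statements are equivalent. (1) There exist formal power series $g(t)$ and $f(t)$, independent of $x$, such that $$P(t,x)=\frac{g(t)}{1-xf(t)},\qquad g(0)\ne 0,\quad f(0)=0,\quad f'(0)\neq 0.$$ (2) There exist formal power series $q(t,x)$, $N_0(t)$, $D_0(t)$, $D_1(t)$ such that $$N(t,x)=q(t,x)N_0(t),\qquad D(t,x)=q(t,x)\bigl(D_0(t)+xD_1(t)\bigr),$$ where $N_0(0)\ne 0$, $D_0(0)\neq 0$, $D_1(0)=0$ and $D_1'(0)\neq 0$. In this case, $$g(t)=\frac{N_0(t)}{D_0(t)},\qquad f(t)=-\frac{D_1(t)}{D_0(t)}.$$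
   Context: All polynomials and formal power series have coefficients in a field $\mathbb K$ of characteristic $0$. Series such as $P(t,x)$ and $q(t,x)$ are formal power series in the indicated variables. -}

module Defs where

open import Level using (Level; _⊔_)
open import Algebra.Bundles using (CommutativeRing)
open import Algebra.Apartness.Bundles using (HeytingField; HeytingCommutativeRing)
open import Algebra.Structures using (IsCommutativeRing)
import Algebra.Definitions as AlgebraDefinitions
import Algebra.Definitions.RawMonoid as RawMonoidDefinitions
import Algebra.Properties.CommutativeSemigroup as CommutativeSemigroupProperties
import Algebra.Properties.Semiring.Sum as SemiringSum
open import Data.Fin.Base using (toℕ)
open import Data.Nat.Base as ℕ using (ℕ; zero; suc; _∸_)
open import Data.Product.Base using (∃-syntax; Σ-syntax; _×_; _,_; proj₁)
open import Function.Base using (_∘_)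
open import Relation.Nullary.Negation.Core using (¬_)
import Relation.Binary.Reasoning.Setoid as SetoidReasoning

private
  variable
    c ℓ ℓ₁ ℓ₂ : Level

-- A formal power series over R is its coefficient sequence; equality is
-- coefficientwise.

module _ (R : CommutativeRing c ℓ) where
  open CommutativeRing R
  open SemiringSum semiring using (sum; sum-syntax)
  open CommutativeSemigroupProperties +-commutativeSemigroup using (interchange)
  open SetoidReasoning setoid

  Series : Set c
  Series = ℕ → Carrier

  private
    infix 4 _≋_
    _≋_ : Series → Series → Set ℓ
    f ≋ g = ∀ n → f n ≈ g n

    infixl 6 _⊕_
    _⊕_ : Series → Series → Series
    (f ⊕ g) n = f n + g n

  monomial : Carrier → ℕ → Series
  monomial r zero    zero    = r
  monomial r zero    (suc _) = 0#
  monomial r (suc _) zero    = 0#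
  monomial r (suc k) (suc n) = monomial r k n

  constant : Carrier → Series
  constant r = monomial r 0

  cauchy : Series → Series → Series
  cauchy f g n = ∑[ i < suc n ] (f (toℕ i) * g (n ∸ toℕ i))

  cauchy-cong : ∀ {f f′ g g′} → f ≋ f′ → g ≋ g′ → cauchy f g ≋ cauchy f′ g′
  cauchy-cong p q zero    = +-congʳ (*-cong (p 0) (q 0))
  cauchy-cong p q (suc n) = +-cong (*-cong (p 0) (q (suc n))) (cauchy-cong (p ∘ suc) q n)

  cauchy-distribʳ : ∀ h f g → cauchy (f ⊕ g) h ≋ (cauchy f h ⊕ cauchy g h)
  cauchy-distribʳ h f g zero = begin
    (f 0 + g 0) * h 0 + 0#                ≈⟨ +-identityʳ _ ⟩
    (f 0 + g 0) * h 0                     ≈⟨ distribʳ _ _ _ ⟩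
    f 0 * h 0 + g 0 * h 0                 ≈⟨ +-cong (+-identityʳ _) (+-identityʳ _) ⟨
    f 0 * h 0 + 0# + (g 0 * h 0 + 0#)     ∎
  cauchy-distribʳ h f g (suc n) = begin
    (f 0 + g 0) * h (suc n) + cauchy ((f ⊕ g) ∘ suc) h n
      ≈⟨ +-cong (distribʳ _ _ _) (cauchy-distribʳ h (f ∘ suc) (g ∘ suc) n) ⟩
    (f 0 * h (suc n) + g 0 * h (suc n)) + (cauchy (f ∘ suc) h n + cauchy (g ∘ suc) h n)
      ≈⟨ interchange _ _ _ _ ⟩
    cauchy f h (suc n) + cauchy g h (suc n) ∎

  cauchy-last : ∀ f g n → cauchy f g (suc n) ≈ cauchy f (g ∘ suc) n + f (suc n) * g 0
  cauchy-last f g zero = begin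
    f 0 * g 1 + (f 1 * g 0 + 0#)   ≈⟨ +-congˡ (+-identityʳ _) ⟩
    f 0 * g 1 + f 1 * g 0          ≈⟨ +-congʳ (+-identityʳ _) ⟨
    f 0 * g 1 + 0# + f 1 * g 0     ∎
  cauchy-last f g (suc n) = begin
    f 0 * g (suc (suc n)) + cauchy (f ∘ suc) g (suc n)
      ≈⟨ +-congˡ (cauchy-last (f ∘ suc) g n) ⟩
    f 0 * g (suc (suc n)) + (cauchy (f ∘ suc) (g ∘ suc) n + f (suc (suc n)) * g 0)
      ≈⟨ +-assoc _ _ _ ⟨
    cauchy f (g ∘ suc) (suc n) + f (suc (suc n)) * g 0 ∎

  cauchy-comm : ∀ f g → cauchy f g ≋ cauchy g f
  cauchy-comm f g zero    = +-congʳ (*-comm _ _)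
  cauchy-comm f g (suc n) = begin
    f 0 * g (suc n) + cauchy (f ∘ suc) g n   ≈⟨ +-cong (*-comm _ _) (cauchy-comm (f ∘ suc) g n) ⟩
    g (suc n) * f 0 + cauchy g (f ∘ suc) n   ≈⟨ +-comm _ _ ⟩
    cauchy g (f ∘ suc) n + g (suc n) * f 0   ≈⟨ cauchy-last g f n ⟨
    cauchy g f (suc n)                       ∎

  cauchy-distribˡ : ∀ h f g → cauchy h (f ⊕ g) ≋ (cauchy h f ⊕ cauchy h g)
  cauchy-distribˡ h f g n = begin
    cauchy h (f ⊕ g) n           ≈⟨ cauchy-comm h (f ⊕ g) n ⟩
    cauchy (f ⊕ g) h n           ≈⟨ cauchy-distribʳ h f g n ⟩
    cauchy f h n + cauchy g h n  ≈⟨ +-cong (cauchy-comm f h n) (cauchy-comm g h n) ⟩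
    cauchy h f n + cauchy h g n  ∎

  cauchy-scale : ∀ r f g n → cauchy (λ k → r * f k) g n ≈ r * cauchy f g n
  cauchy-scale r f g zero = begin
    r * f 0 * g 0 + 0#     ≈⟨ +-identityʳ _ ⟩
    r * f 0 * g 0          ≈⟨ *-assoc _ _ _ ⟩
    r * (f 0 * g 0)        ≈⟨ *-congˡ (+-identityʳ _) ⟨
    r * (f 0 * g 0 + 0#)   ∎
  cauchy-scale r f g (suc n) = begin
    r * f 0 * g (suc n) + cauchy (λ k → r * f (suc k)) g n
      ≈⟨ +-cong (*-assoc _ _ _) (cauchy-scale r (f ∘ suc) g n) ⟩
    r * (f 0 * g (suc n)) + r * cauchy (f ∘ suc) g n
      ≈⟨ distribˡ _ _ _ ⟨
    r * cauchy f g (suc n) ∎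

  cauchy-assoc : ∀ f g h → cauchy (cauchy f g) h ≋ cauchy f (cauchy g h)
  cauchy-assoc f g h zero = +-congʳ (begin
    (f 0 * g 0 + 0#) * h 0   ≈⟨ *-congʳ (+-identityʳ _) ⟩
    f 0 * g 0 * h 0          ≈⟨ *-assoc _ _ _ ⟩
    f 0 * (g 0 * h 0)        ≈⟨ *-congˡ (+-identityʳ _) ⟨
    f 0 * (g 0 * h 0 + 0#)   ∎)
  cauchy-assoc f g h (suc n) = begin
    (f 0 * g 0 + 0#) * h (suc n) + cauchy ((λ k → f 0 * g (suc k)) ⊕ cauchy (f ∘ suc) g) h n
      ≈⟨ +-cong (*-congʳ (+-identityʳ _))
                (cauchy-distribʳ h (λ k → f 0 * g (suc k)) (cauchy (f ∘ suc) g) n) ⟩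
    f 0 * g 0 * h (suc n) + (cauchy (λ k → f 0 * g (suc k)) h n + cauchy (cauchy (f ∘ suc) g) h n)
      ≈⟨ +-cong (*-assoc _ _ _)
                (+-cong (cauchy-scale (f 0) (g ∘ suc) h n) (cauchy-assoc (f ∘ suc) g h n)) ⟩
    f 0 * (g 0 * h (suc n)) + (f 0 * cauchy (g ∘ suc) h n + cauchy (f ∘ suc) (cauchy g h) n)
      ≈⟨ +-assoc _ _ _ ⟨
    f 0 * (g 0 * h (suc n)) + f 0 * cauchy (g ∘ suc) h n + cauchy (f ∘ suc) (cauchy g h) n
      ≈⟨ +-congʳ (distribˡ _ _ _) ⟨
    cauchy f (cauchy g h) (suc n) ∎

  cauchy-zeroˡ : ∀ f → cauchy (λ _ → 0#) f ≋ (λ _ → 0#)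
  cauchy-zeroˡ f zero    = trans (+-identityʳ _) (zeroˡ _)
  cauchy-zeroˡ f (suc n) = trans (+-cong (zeroˡ _) (cauchy-zeroˡ f n)) (+-identityʳ _)

  cauchy-identityˡ : ∀ f → cauchy (constant 1#) f ≋ f
  cauchy-identityˡ f zero    = trans (+-identityʳ _) (*-identityˡ _)
  cauchy-identityˡ f (suc n) = trans (+-cong (*-identityˡ _) (cauchy-zeroˡ f n)) (+-identityʳ _)

  isCommutativeRing-series :
    IsCommutativeRing _≋_ _⊕_ cauchy (λ f n → - f n) (λ _ → 0#) (constant 1#)
  isCommutativeRing-series = record
    { isRing = record
      { +-isAbelianGroup = record
        { isGroup = record
          { isMonoid = record
            { isSemigroup = record
              { isMagma = record
                { isEquivalence = record
                  { refl  = λ _ → refl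
                  ; sym   = λ p n → sym (p n)
                  ; trans = λ p q n → trans (p n) (q n)
                  }
                ; ∙-cong = λ p q n → +-cong (p n) (q n)
                }
              ; assoc = λ f g h n → +-assoc (f n) (g n) (h n)
              }
            ; identity = (λ f n → +-identityˡ (f n)) , (λ f n → +-identityʳ (f n))
            }
          ; inverse = (λ f n → -‿inverseˡ (f n)) , (λ f n → -‿inverseʳ (f n))
          ; ⁻¹-cong = λ p n → -‿cong (p n)
          }
        ; comm = λ f g n → +-comm (f n) (g n)
        }
      ; *-cong = cauchy-cong
      ; *-assoc = cauchy-assoc
      ; *-identity = cauchy-identityˡ
                   , (λ f n → trans (cauchy-comm f (constant 1#) n) (cauchy-identityˡ f n))
      ; distrib = cauchy-distribˡ , cauchy-distribʳ
      }
    ; *-comm = cauchy-comm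
    }

  seriesRing : CommutativeRing c ℓ
  seriesRing = record { isCommutativeRing = isCommutativeRing-series }

  -- The formal derivative evaluated at 0 is the constant term of `derivative`.
  derivative : Series → Series
  derivative f n = suc n ∙ f (suc n)
    where open RawMonoidDefinitions +-rawMonoid using () renaming (_×_ to _∙_)

  IsPolynomial : Series → Set ℓ
  IsPolynomial f = ∃[ d ] (∀ n → d ℕ.< n → f n ≈ 0#)

-- y is the fraction a / b: the denominator b is a unit and y is a times its
-- inverse.
IsQuotient : (R : CommutativeRing c ℓ) (let open CommutativeRing R) →
             Carrier → Carrier → Carrier → Set (c ⊔ ℓ)
IsQuotient R y a b = Σ[ b-unit ∈ Invertible 1# _*_ b ] y ≈ a * proj₁ b-unit
  where
  open CommutativeRing R
  open AlgebraDefinitions _≈_ using (Invertible)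

module BivariateSeries (K : HeytingField c ℓ₁ ℓ₂) where
  open HeytingField K using (_≈_; _#_; 0#; 1#)

  𝕂 : CommutativeRing c ℓ₁
  𝕂 = HeytingCommutativeRing.commutativeRing (HeytingField.heytingCommutativeRing K)

  CharacteristicZero : Set ℓ₁
  CharacteristicZero = ∀ n → ¬ (suc n ∙ 1# ≈ 0#)
    where
    open RawMonoidDefinitions (CommutativeRing.+-rawMonoid 𝕂) using () renaming (_×_ to _∙_)

  -- K[[x]] and K[[t]] are the same ring; K[[t,x]] is K[[x]][[t]], so that
  -- F n k is the coefficient of tⁿxᵏ in F and F 0 is F(0,x).
  𝕂⟦x⟧ 𝕂⟦t⟧ 𝕂⟦t,x⟧ : CommutativeRing c ℓ₁
  𝕂⟦x⟧   = seriesRing 𝕂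
  𝕂⟦t⟧   = seriesRing 𝕂
  𝕂⟦t,x⟧ = seriesRing 𝕂⟦x⟧

  module X  = CommutativeRing 𝕂⟦x⟧
  module T  = CommutativeRing 𝕂⟦t⟧
  module TX = CommutativeRing 𝕂⟦t,x⟧

  open SemiringSum X.semiring using () renaming (sum-syntax to X-sum)
  open SemiringSum TX.semiring using () renaming (sum-syntax to TX-sum)

  x : TX.Carrier
  x = constant 𝕂⟦x⟧ (monomial 𝕂 1# 1)

  -- A series in t alone, seen as a series in t and x.
  ⌜_⌝ : T.Carrier → TX.Carrier
  ⌜ f ⌝ n = constant 𝕂 (f n)

  -- The recurrence coefficients a₁,…,a_ℓ are taken from a sequence a whose other entries
  -- play no role. A sum over 1 ≤ j ≤ m is indexed by i = j - 1 ∈ Fin m.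
  module _ (ℓ : ℕ) (a : ℕ → X.Carrier) where

    Recurrence : (ℕ → X.Carrier) → Set ℓ₁
    Recurrence p = ∀ n →
      p (n ℕ.+ ℓ) X.≈ X-sum ℓ (λ i → a (suc (toℕ i)) X.* p (n ℕ.+ ℓ ∸ suc (toℕ i)))

    denominator : TX.Carrier
    denominator =
      TX.1# TX.- TX-sum ℓ (λ i → monomial 𝕂⟦x⟧ (a (suc (toℕ i))) (suc (toℕ i)))

    numerator : (ℕ → X.Carrier) → TX.Carrier
    numerator p = TX-sum ℓ (λ m → monomial 𝕂⟦x⟧ (initial (toℕ m)) (toℕ m))
      where
      initial : ℕ → X.Carrier
      initial m = p m X.- X-sum m (λ i → a (suc (toℕ i)) X.* p (m ∸ suc (toℕ i)))

  -- The field is a Heyting field, so y ≠ 0 is rendered by the apartness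
  -- y # 0#, which is equivalent to y being a unit.

  RiordanForm : TX.Carrier → T.Carrier → T.Carrier → Set (c ⊔ ℓ₁ ⊔ ℓ₂)
  RiordanForm P g f =
    IsQuotient 𝕂⟦t,x⟧ P ⌜ g ⌝ (TX.1# TX.- x TX.* ⌜ f ⌝) ×
    g 0 # 0# × f 0 ≈ 0# × derivative 𝕂 f 0 # 0#

  CommonFactorForm : (N D q : TX.Carrier) (N₀ D₀ D₁ : T.Carrier) → Set (ℓ₁ ⊔ ℓ₂)
  CommonFactorForm N D q N₀ D₀ D₁ =
    N TX.≈ q TX.* ⌜ N₀ ⌝ ×
    D TX.≈ q TX.* (⌜ D₀ ⌝ TX.+ x TX.* ⌜ D₁ ⌝) ×
    N₀ 0 # 0# × D₀ 0 # 0# × D₁ 0 ≈ 0# × derivative 𝕂 D₁ 0 # 0#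

{-# OPTIONS --safe #-}
-- Both forms say that P (A + x B) = C for series A, B, C in t alone: (1) with
-- A = 1, B = - f, C = g, and (2), after cancelling the unit q, with A = D₀,
-- B = D₁, C = N₀. One passes between them by dividing by the unit D₀, and two
-- such equations for the same P are compared through the coefficients of x⁰ and
-- x¹. That q is a unit follows from D = q (D₀ + x D₁) and D(0,x) = 1.
module Submission where

open import Defs
open import Algebra.Apartness.Bundles using (HeytingField)
open import Data.Nat.Base using (ℕ; _≤_)
open import Data.Product.Base using (∃-syntax; _×_)
open import Function.Bundles using (_⇔_)

open import Algebra.Bundles using (CommutativeRing)
import Algebra.Apartness.Properties.HeytingCommutativeRing as HeytingProperties
import Algebra.Definitions as AlgebraDefinitions
import Algebra.Properties.CommutativeMonoid as CommutativeMonoidProperties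
import Algebra.Properties.CommutativeSemigroup as CommutativeSemigroupProperties
import Algebra.Properties.Ring as RingProperties
import Algebra.Properties.Semiring.Sum as SemiringSum
open import Data.Fin.Base using (Fin; toℕ)
open import Data.Nat.Base using (zero; suc; _∸_; _<_; s≤s; s≤s⁻¹)
open import Data.Nat.Properties using (<⇒≤; <-≤-connex; m∸n+n≡m; n≮0; ≤-trans)
open import Data.Product.Base using (_,_)
open import Data.Sum.Base using (inj₁; inj₂)
open import Function.Base using (_∘_)
open import Function.Bundles using (mk⇔)
open import Relation.Nullary.Negation.Core using (contradiction)
import Relation.Binary.PropositionalEquality.Core as ≡
import Relation.Binary.Reasoning.Setoid as SetoidReasoning

-- Units and fractions in a commutative ring.

module Units {c ℓ} (R : CommutativeRing c ℓ) where
  open CommutativeRing R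
  open AlgebraDefinitions _≈_ using (Invertible)
  open CommutativeMonoidProperties *-commutativeMonoid using (invertibleʳ⇒invertible)
  open RingProperties ring using (-1*x≈-x; -‿involutive)
  open SetoidReasoning setoid

  Unit : Carrier → Set _
  Unit = Invertible 1# _*_

  unit-resp : ∀ {a b} → a ≈ b → Unit a → Unit b
  unit-resp a≈b (u , _ , au≈1) = invertibleʳ⇒invertible (u , trans (*-congʳ (sym a≈b)) au≈1)

  unit-factorˡ : ∀ {a b} → Unit (a * b) → Unit a
  unit-factorˡ {a} {b} (u , _ , abu≈1) =
    invertibleʳ⇒invertible (b * u , trans (sym (*-assoc a b u)) abu≈1)

  unit-factorʳ : ∀ {a b} → Unit (a * b) → Unit b
  unit-factorʳ = unit-factorˡ ∘ unit-resp (*-comm _ _)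

  -- The product of `- 1#` and `- a` is the unit `a`, and a factor of a unit is a unit.
  unit-neg : ∀ {a} → Unit a → Unit (- a)
  unit-neg {a} a-unit = unit-factorʳ (unit-resp a≈-1*-a a-unit)
    where
    a≈-1*-a : a ≈ - 1# * - a
    a≈-1*-a = sym (trans (-1*x≈-x (- a)) (-‿involutive a))

  unit-cancelʳ : ∀ {a b u} → Unit u → a * u ≈ b * u → a ≈ b
  unit-cancelʳ {a} {b} {u} (v , _ , uv≈1) au≈bu = begin
    a            ≈⟨ *-identityʳ a ⟨
    a * 1#       ≈⟨ *-congˡ uv≈1 ⟨
    a * (u * v)  ≈⟨ *-assoc a u v ⟨
    a * u * v    ≈⟨ *-congʳ au≈bu ⟩
    b * u * v    ≈⟨ *-assoc b u v ⟩
    b * (u * v)  ≈⟨ *-congˡ uv≈1 ⟩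
    b * 1#       ≈⟨ *-identityʳ b ⟩
    b            ∎

  *-inverse-cancel : ∀ a v u → v * u ≈ 1# → a * v * u ≈ a
  *-inverse-cancel a v u vu≈1 = trans (*-assoc _ _ _) (trans (*-congˡ vu≈1) (*-identityʳ a))

  quotient⇒product : ∀ {y a b} → IsQuotient R y a b → y * b ≈ a
  quotient⇒product {y} {a} {b} ((u , ub≈1 , _) , y≈au) =
    trans (*-congʳ y≈au) (*-inverse-cancel a u b ub≈1)

  product⇒quotient : ∀ {y a b} → Unit b → y * b ≈ a → IsQuotient R y a b
  product⇒quotient {y} {a} {b} b-unit@(u , ub≈1 , _) yb≈a =
    b-unit , unit-cancelʳ b-unit (trans yb≈a (sym (*-inverse-cancel a u b ub≈1)))

-- Power series in one variable: constants, shifts and division.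

module SeriesProperties {c ℓ} (R : CommutativeRing c ℓ) where
  open CommutativeRing R hiding (zero)
  open SemiringSum semiring using (sum; sum-cong-≋; sum-replicate-zero)
  open RingProperties ring using (-0#≈0#)
  open SetoidReasoning setoid
  private
    module S = CommutativeRing (seriesRing R)
    module ΣS = SemiringSum S.semiring

  constant-cong : ∀ {r s} → r ≈ s → constant R r S.≈ constant R s
  constant-cong r≈s zero    = r≈s
  constant-cong r≈s (suc _) = refl

  constant-0 : constant R 0# S.≈ S.0#
  constant-0 zero    = refl
  constant-0 (suc _) = refl

  constant-+ : ∀ r s → constant R (r + s) S.≈ constant R r S.+ constant R s
  constant-+ r s zero    = refl
  constant-+ r s (suc _) = sym (+-identityˡ 0#)

  constant-neg : ∀ r → constant R (- r) S.≈ S.- constant R r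
  constant-neg r zero    = refl
  constant-neg r (suc _) = sym -0#≈0#

  constant-scale : ∀ r f n → (constant R r S.* f) n ≈ r * f n
  constant-scale r f zero    = +-identityʳ _
  constant-scale r f (suc n) = trans (+-congˡ (cauchy-zeroˡ R f n)) (+-identityʳ _)

  constant-* : ∀ r s → constant R (r * s) S.≈ constant R r S.* constant R s
  constant-* r s zero    = sym (constant-scale r (constant R s) zero)
  constant-* r s (suc n) = sym (trans (constant-scale r (constant R s) (suc n)) (zeroʳ r))

  X : S.Carrier
  X = monomial R 1# 1

  X-shift-zero : ∀ f → (X S.* f) 0 ≈ 0#
  X-shift-zero f = trans (+-identityʳ _) (zeroˡ _)

  X-shift-suc : ∀ f n → (X S.* f) (suc n) ≈ f n
  X-shift-suc f n = trans (+-cong (zeroˡ _) (cauchy-identityˡ R f n)) (+-identityˡ _)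

  -- Serves to carry the condition on the derivative at 0 from `D₁` over to `D₁ / D₀`.
  *-coefficient-1 : ∀ {f} g → f 0 ≈ 0# → (f S.* g) 1 ≈ f 1 * g 0
  *-coefficient-1 {f} g f₀≈0 = begin
    f 0 * g 1 + (f 1 * g 0 + 0#)  ≈⟨ +-cong (trans (*-congʳ f₀≈0) (zeroˡ _)) (+-identityʳ _) ⟩
    0# + f 1 * g 0                ≈⟨ +-identityˡ _ ⟩
    f 1 * g 0                     ∎

  -- Long division of r by b, where u is the inverse of b 0: each step replaces r
  -- by (r - u (r 0) b) / t.
  module _ (b : S.Carrier) (u : Carrier) (ub₀≈1 : u * b 0 ≈ 1#) where

    remainder : S.Carrier → S.Carrier
    remainder r n = r (suc n) - r 0 * u * b (suc n)

    quotient : S.Carrier → S.Carrier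
    quotient r zero    = r 0 * u
    quotient r (suc n) = quotient (remainder r) n

    quotient-* : ∀ r → quotient r S.* b S.≈ r
    quotient-* r zero    = trans (+-identityʳ _) (Units.*-inverse-cancel R (r 0) u (b 0) ub₀≈1)
    quotient-* r (suc n) = begin
      -- The tail of `quotient r` is `quotient (remainder r)` by computation, so the Cauchy product
      -- unfolds to this sum. The induction hypothesis then returns `remainder r`, whose subtracted
      -- term is exactly `e`.
      e + (quotient (remainder r) S.* b) n  ≈⟨ +-congˡ (quotient-* (remainder r) n) ⟩
      e + (r (suc n) - e)                   ≈⟨ +-comm _ _ ⟩
      r (suc n) - e + e                     ≈⟨ +-assoc _ _ _ ⟩
      r (suc n) + (- e + e)                 ≈⟨ +-congˡ (-‿inverseˡ e) ⟩
      r (suc n) + 0#                        ≈⟨ +-identityʳ _ ⟩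
      r (suc n)                             ∎
      where
      e : Carrier
      e = r 0 * u * b (suc n)

  -- Long division of 1 by `b` gives a left inverse, which suffices by commutativity.
  series-unit : ∀ {b} → Units.Unit R (b 0) → Units.Unit (seriesRing R) b
  series-unit {b} (u , ub₀≈1 , _) =
    CommutativeMonoidProperties.invertibleˡ⇒invertible S.*-commutativeMonoid
      (quotient b u ub₀≈1 S.1# , quotient-* b u ub₀≈1 S.1#)

  -- Finite sums of monomials and their products.

  sum-coefficient : ∀ {m} (F : Fin m → S.Carrier) n → ΣS.sum F n ≈ sum (λ i → F i n)
  sum-coefficient {zero}  F n = refl
  sum-coefficient {suc m} F n = +-congˡ (sum-coefficient (F ∘ Fin.suc) n)

  -- The polynomial part of `h` of degree below `m`. Summing in `R`, one coefficient at a time, lets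
  -- the shift by one variable power compute inside `monomial`; `sum-coefficient` brings the sums of
  -- series in the numerator and denominator to this form.
  truncate : ℕ → S.Carrier → S.Carrier
  truncate m h n = sum {m} (λ i → monomial R (h (toℕ i)) (toℕ i) n)

  truncate-suc-zero : ∀ m h → truncate (suc m) h 0 ≈ h 0
  truncate-suc-zero m h = trans (+-congˡ (sum-replicate-zero m)) (+-identityʳ _)

  truncate-suc-suc : ∀ m h → truncate (suc m) h ∘ suc S.≈ truncate m (h ∘ suc)
  truncate-suc-suc m h n = +-identityˡ _

  truncate-below : ∀ {m n} h → n < m → truncate m h n ≈ h n
  truncate-below {suc m} {zero}  h _   = truncate-suc-zero m h
  truncate-below {suc m} {suc n} h n<m =
    trans (truncate-suc-suc m h n) (truncate-below (h ∘ suc) (s≤s⁻¹ n<m))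

  truncate-above : ∀ {m n} h → m ≤ n → truncate m h n ≈ 0#
  truncate-above {zero}          h _   = refl
  truncate-above {suc m} {suc n} h m≤n =
    trans (truncate-suc-suc m h n) (truncate-above (h ∘ suc) (s≤s⁻¹ m≤n))

  -- Coefficient `n` of a product sees only coefficients 0 to `n` of the first factor, and
  -- truncation at `m` keeps all of these.
  truncate-*-below : ∀ {m n} h p → n < m → (truncate m h S.* p) n ≈ (h S.* p) n
  truncate-*-below {suc m} {zero}  h p _   = +-congʳ (*-congʳ (truncate-suc-zero m h))
  truncate-*-below {suc m} {suc n} h p n<m = +-cong
    (*-congʳ (truncate-suc-zero m h))
    (trans (cauchy-cong R {g = p} (truncate-suc-suc m h) (λ _ → refl) n)
           (truncate-*-below (h ∘ suc) p (s≤s⁻¹ n<m)))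

  -- Only the `m` kept coefficients contribute. The bound `m ≤ suc n` ensures `i ≤ n` for every
  -- `i < m`, so that `∸` is genuine subtraction.
  truncate-*-above : ∀ {m n} h p → m ≤ suc n →
    (truncate m h S.* p) n ≈ sum {m} (λ i → h (toℕ i) * p (n ∸ toℕ i))
  truncate-*-above {zero}        {n}     h p _   = cauchy-zeroˡ R p n
  truncate-*-above {suc zero}    {zero}  h p _   = +-congʳ (*-congʳ (truncate-suc-zero 0 h))
  truncate-*-above {suc (suc m)} {zero}  h p (s≤s ())
  truncate-*-above {suc m}       {suc n} h p m≤n = +-cong
    (*-congʳ (truncate-suc-zero m h))
    (trans (cauchy-cong R {g = p} (truncate-suc-suc m h) (λ _ → refl) n)
           (truncate-*-above (h ∘ suc) p (s≤s⁻¹ m≤n)))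

-- The coefficient field: apartness from zero as invertibility.

module _ {c ℓ₁ ℓ₂} (K : HeytingField c ℓ₁ ℓ₂) where
  open BivariateSeries K
  private
    module K = HeytingField K
    module Kᴿ = CommutativeRing 𝕂
    module KP = SeriesProperties 𝕂
    module XP = SeriesProperties 𝕂⟦x⟧
    module UT = Units 𝕂⟦t⟧
    module UTX = Units 𝕂⟦t,x⟧
    module HP = HeytingProperties K.heytingCommutativeRing
    module TR = RingProperties T.ring
    module TXR = RingProperties TX.ring
    module ΣX = SemiringSum X.semiring
  open K using (_≈_; _#_; 0#; 1#)
  open Units 𝕂 using (Unit; unit-resp; unit-factorˡ)

  -- In a Heyting field apartness of two elements means that their difference is invertible; here
  -- the difference is `r - 0#`. All nonvanishing conditions are then handled as statements about
  -- units.
  #0⇒unit : ∀ {r} → r # 0# → Unit r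
  #0⇒unit {r} r#0 = unit-resp (HP.x-0≈x r) (K.#⇒invertible r#0)

  unit⇒#0 : ∀ {r} → Unit r → r # 0#
  unit⇒#0 {r} r-unit = K.invertible⇒# (unit-resp (K.sym (HP.x-0≈x r)) r-unit)

  derivative-0 : ∀ f → derivative 𝕂 f 0 ≈ f 1
  derivative-0 f = K.+-identityʳ (f 1)

  -- The recurrence as the identity P D = N.

  module RecurrenceProperties (ℓ : ℕ) (a p : ℕ → X.Carrier) where

    Σa : TX.Carrier
    Σa = SemiringSum.sum TX.semiring {ℓ} (λ i → monomial 𝕂⟦x⟧ (a (suc (toℕ i))) (suc (toℕ i)))

    Σa-zero : Σa 0 X.≈ X.0#
    Σa-zero = X.trans (XP.sum-coefficient {ℓ} _ 0) (ΣX.sum-replicate-zero ℓ)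

    -- Every exponent in `Σa` is at least 1. Dividing by t lowers each exponent by one, which
    -- `monomial` does by computation.
    Σa-suc : Σa ∘ suc TX.≈ XP.truncate ℓ (a ∘ suc)
    Σa-suc n = XP.sum-coefficient {ℓ} _ (suc n)

    Σa-*-zero : (Σa TX.* p) 0 X.≈ X.0#
    Σa-*-zero = X.trans (X.+-identityʳ _) (X.trans (X.*-congʳ Σa-zero) (X.zeroˡ (p 0)))

    Σa-*-suc : ∀ n → (Σa TX.* p) (suc n) X.≈ (XP.truncate ℓ (a ∘ suc) TX.* p) n
    Σa-*-suc n = X.trans
      (X.+-cong (X.trans (X.*-congʳ Σa-zero) (X.zeroˡ (p (suc n))))
                (cauchy-cong 𝕂⟦x⟧ {g = p} Σa-suc (λ _ → X.refl) n))
      (X.+-identityˡ _)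

    denominator-0 : denominator ℓ a 0 X.≈ X.1#
    denominator-0 = begin
      X.1# X.- Σa 0  ≈⟨ X.+-congˡ (X.-‿cong Σa-zero) ⟩
      X.1# X.- X.0#  ≈⟨ X.+-congˡ (RingProperties.-0#≈0# X.ring) ⟩
      X.1# X.+ X.0#  ≈⟨ X.+-identityʳ X.1# ⟩
      X.1#           ∎
      where open SetoidReasoning X.setoid

    denominator-unit : UTX.Unit (denominator ℓ a)
    denominator-unit =
      XP.series-unit (Units.unit-resp 𝕂⟦x⟧ (X.sym denominator-0)
        (X.1# , X.*-identityˡ _ , X.*-identityʳ _))

    *-denominator-expand : p TX.* denominator ℓ a TX.≈ p TX.- Σa TX.* p
    *-denominator-expand = begin
      p TX.* (TX.1# TX.- Σa)             ≈⟨ TXR.x[y-z]≈xy-xz p TX.1# Σa ⟩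
      p TX.* TX.1# TX.- p TX.* Σa        ≈⟨ TX.+-cong (TX.*-identityʳ p) (TX.-‿cong (TX.*-comm p Σa)) ⟩
      p TX.- Σa TX.* p                   ∎
      where open SetoidReasoning TX.setoid

    -- The recurrence at `n ∸ ℓ`, transported along `n ∸ ℓ + ℓ ≡ n`.
    recurrence-from : Recurrence ℓ a p → ∀ {n} → ℓ ≤ n →
      p n X.≈ ΣX.sum {ℓ} (λ i → a (suc (toℕ i)) X.* p (n ∸ suc (toℕ i)))
    recurrence-from rec {n} ℓ≤n = ≡.subst
      (λ n → p n X.≈ ΣX.sum {ℓ} (λ i → a (suc (toℕ i)) X.* p (n ∸ suc (toℕ i))))
      (m∸n+n≡m ℓ≤n) (rec (n ∸ ℓ))

    -- Coefficient n of P D is p_n minus the sum of the a_j p_{n-j} over 1 ≤ j ≤ min(n, ℓ). For n <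
    -- ℓ this is the numerator coefficient; for n ≥ ℓ the recurrence makes it vanish.
    *-denominator : Recurrence ℓ a p → 1 ≤ ℓ → p TX.* denominator ℓ a TX.≈ numerator ℓ a p
    *-denominator rec 1≤ℓ n = X.trans (*-denominator-expand n)
      (X.trans (coefficient n) (X.sym numerator-coefficient))
      where
      initial : ℕ → X.Carrier
      initial m = p m X.- ΣX.sum {m} (λ i → a (suc (toℕ i)) X.* p (m ∸ suc (toℕ i)))

      numerator-coefficient : numerator ℓ a p n X.≈ XP.truncate ℓ initial n
      numerator-coefficient = XP.sum-coefficient {ℓ} _ n

      coefficient : ∀ n → p n X.- (Σa TX.* p) n X.≈ XP.truncate ℓ initial n
      coefficient n with <-≤-connex n ℓ
      coefficient zero | inj₁ n<ℓ = X.trans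
        (X.+-congˡ (X.-‿cong Σa-*-zero)) (X.sym (XP.truncate-below initial n<ℓ))
      -- Here `n<ℓ` says `suc n < ℓ`, but the product with the shifted coefficients is read at `n`,
      -- hence the weakening. The resulting sum is the one in `initial (suc n)`, since
      -- `suc n ∸ suc i` computes to `n ∸ i`.
      coefficient (suc n) | inj₁ n<ℓ = X.trans
        (X.+-congˡ (X.-‿cong (X.trans (Σa-*-suc n)
          (XP.truncate-*-below (a ∘ suc) p (<⇒≤ n<ℓ)))))
        (X.sym (XP.truncate-below initial n<ℓ))
      coefficient zero | inj₂ ℓ≤0 = contradiction (≤-trans 1≤ℓ ℓ≤0) n≮0
      coefficient (suc n) | inj₂ ℓ≤n = begin
        p (suc n) X.- (Σa TX.* p) (suc n)
          ≈⟨ X.+-congˡ (X.-‿cong (X.trans (Σa-*-suc n) (XP.truncate-*-above (a ∘ suc) p ℓ≤n))) ⟩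
        p (suc n) X.- ΣX.sum {ℓ} (λ i → a (suc (toℕ i)) X.* p (n ∸ toℕ i))
          ≈⟨ X.+-congˡ (X.-‿cong (recurrence-from rec ℓ≤n)) ⟨
        p (suc n) X.- p (suc n)
          ≈⟨ X.-‿inverseʳ (p (suc n)) ⟩
        X.0#
          ≈⟨ XP.truncate-above initial ℓ≤n ⟨
        XP.truncate ℓ initial (suc n) ∎
        where open SetoidReasoning X.setoid

  -- Series in t inside the bivariate ring, and forms linear in x.

  ⌜⌝-cong : ∀ {f g} → f T.≈ g → ⌜ f ⌝ TX.≈ ⌜ g ⌝
  ⌜⌝-cong f≈g n = KP.constant-cong (f≈g n)

  ⌜⌝-1 : ⌜ T.1# ⌝ TX.≈ TX.1#
  ⌜⌝-1 zero    = X.refl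
  ⌜⌝-1 (suc n) = KP.constant-0

  -- Induction on the index with `f` varying: the Cauchy product sheds the first coefficient of `f`,
  -- and embedding commutes with that shift. What remains is that constants respect sums and
  -- products.
  ⌜⌝-* : ∀ f g → ⌜ f T.* g ⌝ TX.≈ ⌜ f ⌝ TX.* ⌜ g ⌝
  ⌜⌝-* f g zero    = X.trans (KP.constant-+ (f 0 K.* g 0) 0#)
    (X.+-cong (KP.constant-* (f 0) (g 0)) KP.constant-0)
  ⌜⌝-* f g (suc n) = X.trans (KP.constant-+ (f 0 K.* g (suc n)) _)
    (X.+-cong (KP.constant-* (f 0) (g (suc n))) (⌜⌝-* (f ∘ suc) g n))

  infix 6 _+x_

  -- The common shape of both denominators; it unfolds to the second factor of `D` in
  -- `CommonFactorForm`.
  _+x_ : T.Carrier → T.Carrier → TX.Carrier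
  A +x B = ⌜ A ⌝ TX.+ x TX.* ⌜ B ⌝

  +x-cong : ∀ {A A′ B B′} → A T.≈ A′ → B T.≈ B′ → A +x B TX.≈ A′ +x B′
  +x-cong A≈A′ B≈B′ = TX.+-cong (⌜⌝-cong A≈A′) (TX.*-congˡ {x} (⌜⌝-cong B≈B′))

  -- As a series in t, `x` is constant, so it multiplies each t-coefficient separately.
  x-*-coefficient : ∀ F n → (x TX.* F) n X.≈ KP.X X.* F n
  x-*-coefficient = XP.constant-scale KP.X

  +x-coefficient-0 : ∀ A B n → (A +x B) n 0 ≈ A n
  +x-coefficient-0 A B n = K.trans
    (K.+-congˡ (K.trans (x-*-coefficient ⌜ B ⌝ n 0) (KP.X-shift-zero (⌜ B ⌝ n))))
    (K.+-identityʳ _)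

  +x-coefficient-1 : ∀ A B n → (A +x B) n 1 ≈ B n
  +x-coefficient-1 A B n = K.trans
    (K.+-congˡ (K.trans (x-*-coefficient ⌜ B ⌝ n 1) (KP.X-shift-suc (⌜ B ⌝ n) 0)))
    (K.+-identityˡ _)

  +x-injectiveˡ : ∀ {A A′ B B′} → A +x B TX.≈ A′ +x B′ → A T.≈ A′
  +x-injectiveˡ {A} {A′} {B} {B′} eq n = K.trans
    (K.sym (+x-coefficient-0 A B n)) (K.trans (eq n 0) (+x-coefficient-0 A′ B′ n))

  +x-injectiveʳ : ∀ {A A′ B B′} → A +x B TX.≈ A′ +x B′ → B T.≈ B′
  +x-injectiveʳ {A} {A′} {B} {B′} eq n = K.trans
    (K.sym (+x-coefficient-1 A B n)) (K.trans (eq n 1) (+x-coefficient-1 A′ B′ n))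

  -- Invertibility descends twice to a constant term: first in t, then in x, where only `A 0` is
  -- left.
  +x-unit : ∀ {A B} → Unit (A 0) → UTX.Unit (A +x B)
  +x-unit {A} {B} A₀-unit =
    XP.series-unit (KP.series-unit (unit-resp (K.sym (+x-coefficient-0 A B 0)) A₀-unit))

  ⌜⌝-*-+x : ∀ h A B → ⌜ h ⌝ TX.* (A +x B) TX.≈ (h T.* A) +x (h T.* B)
  ⌜⌝-*-+x h A B = begin
    ⌜ h ⌝ TX.* (⌜ A ⌝ TX.+ x TX.* ⌜ B ⌝)
      ≈⟨ TX.distribˡ ⌜ h ⌝ ⌜ A ⌝ (x TX.* ⌜ B ⌝) ⟩
    ⌜ h ⌝ TX.* ⌜ A ⌝ TX.+ ⌜ h ⌝ TX.* (x TX.* ⌜ B ⌝)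
      ≈⟨ TX.+-cong (TX.sym (⌜⌝-* h A)) (x∙yz≈y∙xz ⌜ h ⌝ x ⌜ B ⌝) ⟩
    ⌜ h T.* A ⌝ TX.+ x TX.* (⌜ h ⌝ TX.* ⌜ B ⌝)
      ≈⟨ TX.+-congˡ (TX.*-congˡ {x} (⌜⌝-* h B)) ⟨
    (h T.* A) +x (h T.* B) ∎
    where
    open SetoidReasoning TX.setoid
    open CommutativeSemigroupProperties TX.*-commutativeSemigroup using (x∙yz≈y∙xz)

  1-x≈1+x : ∀ f → TX.1# TX.- x TX.* ⌜ f ⌝ TX.≈ T.1# +x (T.- f)
  1-x≈1+x f = TX.+-cong (TX.sym ⌜⌝-1)
    (TX.trans (TXR.-‿distribʳ-* x ⌜ f ⌝) (TX.*-congˡ {x} (λ n → X.sym (KP.constant-neg (f n)))))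

  -- Passing between the two forms, and the formulas for g and f.

  module _ {P N D : TX.Carrier} (PD≈N : P TX.* D TX.≈ N) where
    open CommutativeSemigroupProperties TX.*-commutativeSemigroup
      using (xy∙z≈xz∙y; x∙yz≈y∙xz; x∙yz≈xz∙y)

    riordan-product : ∀ {g f} → RiordanForm P g f → P TX.* (T.1# +x (T.- f)) TX.≈ ⌜ g ⌝
    riordan-product {f = f} (P-quotient , _) =
      TX.trans (TX.*-congˡ {P} (TX.sym (1-x≈1+x f))) (UTX.quotient⇒product P-quotient)

    common-factor-product : UTX.Unit D → ∀ {q N₀ D₀ D₁} → CommonFactorForm N D q N₀ D₀ D₁ →
      P TX.* (D₀ +x D₁) TX.≈ ⌜ N₀ ⌝
    common-factor-product D-unit {q} {N₀} {D₀} {D₁} (N≈qN₀ , D≈qE , _) =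
      UTX.unit-cancelʳ (UTX.unit-factorˡ (UTX.unit-resp D≈qE D-unit)) (begin
        P TX.* (D₀ +x D₁) TX.* q    ≈⟨ x∙yz≈xz∙y P q (D₀ +x D₁) ⟨
        P TX.* (q TX.* (D₀ +x D₁))  ≈⟨ TX.*-congˡ {P} D≈qE ⟨
        P TX.* D                    ≈⟨ PD≈N ⟩
        N                           ≈⟨ N≈qN₀ ⟩
        q TX.* ⌜ N₀ ⌝               ≈⟨ TX.*-comm q ⌜ N₀ ⌝ ⟩
        ⌜ N₀ ⌝ TX.* q               ∎)
      where open SetoidReasoning TX.setoid

    riordan⇒common-factor : ∃[ g ] ∃[ f ] RiordanForm P g f →
      ∃[ q ] ∃[ N₀ ] ∃[ D₀ ] ∃[ D₁ ] CommonFactorForm N D q N₀ D₀ D₁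
    riordan⇒common-factor (g , f , riordan@(((u , uL≈1 , _) , _) , g₀#0 , f₀≈0 , f₁#0)) =
      q , g , T.1# , T.- f , N≈qg , D≈qL , g₀#0 , HP.1#0 ,
      K.trans (K.-‿cong f₀≈0) (RingProperties.-0#≈0# Kᴿ.ring) ,
      unit⇒#0 (unit-resp (K.sym (derivative-0 (T.- f)))
        (Units.unit-neg 𝕂 (unit-resp (derivative-0 f) (#0⇒unit f₁#0))))
      where
      open SetoidReasoning TX.setoid
      L q : TX.Carrier
      L = T.1# +x (T.- f)
      -- With `D₀` normalised to 1 and `D₁ = - f`, the equation `D = q L` forces `q = D / L`. The
      -- inverse `u` of `1 - x f` is part of the given quotient.
      q = D TX.* u
      D≈qL : D TX.≈ q TX.* L
      D≈qL = TX.sym (UTX.*-inverse-cancel D u L (TX.trans (TX.*-congˡ {u} (TX.sym (1-x≈1+x f))) uL≈1))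
      N≈qg : N TX.≈ q TX.* ⌜ g ⌝
      N≈qg = begin
        N                  ≈⟨ PD≈N ⟨
        P TX.* D           ≈⟨ TX.*-congˡ {P} D≈qL ⟩
        P TX.* (q TX.* L)  ≈⟨ x∙yz≈y∙xz P q L ⟩
        q TX.* (P TX.* L)  ≈⟨ TX.*-congˡ {q} (riordan-product {g} riordan) ⟩
        q TX.* ⌜ g ⌝       ∎

    common-factor⇒riordan : UTX.Unit D →
      ∃[ q ] ∃[ N₀ ] ∃[ D₀ ] ∃[ D₁ ] CommonFactorForm N D q N₀ D₀ D₁ →
      ∃[ g ] ∃[ f ] RiordanForm P g f
    common-factor⇒riordan D-unit
      (q , N₀ , D₀ , D₁ , common@(_ , _ , N₀₀#0 , D₀₀#0 , D₁₀≈0 , D₁₁#0))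
      -- Multiplying `D₀ +x D₁` by the inverse `v` of `D₀` makes its part free of x equal to 1 and
      -- leaves `w = D₁ / D₀` beside x, so f must be `- w`.
      with KP.series-unit {D₀} (#0⇒unit D₀₀#0)
    ... | v , vD₀≈1 , _ =
      g , T.- w ,
      UTX.product⇒quotient
        (UTX.unit-resp L≈1-xf (+x-unit {T.1#} {w} (#0⇒unit HP.1#0)))
        (TX.trans (TX.*-congˡ {P} (TX.sym L≈1-xf)) PL≈g) ,
      -- From `N₀ = g D₀`, the value `g 0` is a factor of the unit `N₀ 0`. The derivative is treated
      -- alike through `D₁ = w D₀`, where `w 0 ≈ 0#` leaves only `w 1 * D₀ 0` in degree 1.
      unit⇒#0 (unit-factorˡ (unit-resp N₀₀≈g₀D₀₀ (#0⇒unit N₀₀#0))) ,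
      K.trans (K.-‿cong w₀≈0) (RingProperties.-0#≈0# Kᴿ.ring) ,
      unit⇒#0 (unit-resp (K.sym (derivative-0 (T.- w)))
        (Units.unit-neg 𝕂 (unit-factorˡ (unit-resp D₁₁≈w₁D₀₀ (#0⇒unit D₁₁#0)))))
      where
      open SetoidReasoning TX.setoid
      g w : T.Carrier
      g = N₀ T.* v
      w = D₁ T.* v
      L≈1-xf : T.1# +x w TX.≈ TX.1# TX.- x TX.* ⌜ T.- w ⌝
      L≈1-xf = TX.trans (+x-cong T.refl (T.sym (TR.-‿involutive w))) (TX.sym (1-x≈1+x (T.- w)))
      vE≈L : ⌜ v ⌝ TX.* (D₀ +x D₁) TX.≈ T.1# +x w
      vE≈L = TX.trans (⌜⌝-*-+x v D₀ D₁) (+x-cong vD₀≈1 (T.*-comm v D₁))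
      PL≈g : P TX.* (T.1# +x w) TX.≈ ⌜ g ⌝
      PL≈g = begin
        P TX.* (T.1# +x w)                 ≈⟨ TX.*-congˡ {P} vE≈L ⟨
        P TX.* (⌜ v ⌝ TX.* (D₀ +x D₁))     ≈⟨ x∙yz≈xz∙y P ⌜ v ⌝ (D₀ +x D₁) ⟩
        P TX.* (D₀ +x D₁) TX.* ⌜ v ⌝       ≈⟨ TX.*-congʳ {⌜ v ⌝} (common-factor-product D-unit {q} common) ⟩
        ⌜ N₀ ⌝ TX.* ⌜ v ⌝                  ≈⟨ ⌜⌝-* N₀ v ⟨
        ⌜ g ⌝                              ∎
      N₀₀≈g₀D₀₀ : N₀ 0 ≈ g 0 K.* D₀ 0
      N₀₀≈g₀D₀₀ = K.trans (K.sym (UT.*-inverse-cancel N₀ v D₀ vD₀≈1 0)) (K.+-identityʳ _)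
      w₀≈0 : w 0 ≈ 0#
      w₀≈0 = K.trans (K.+-identityʳ _) (K.trans (K.*-congʳ D₁₀≈0) (Kᴿ.zeroˡ (v 0)))
      D₁₁≈w₁D₀₀ : derivative 𝕂 D₁ 0 ≈ w 1 K.* D₀ 0
      D₁₁≈w₁D₀₀ = K.trans (derivative-0 D₁) (K.trans
        (K.sym (UT.*-inverse-cancel D₁ v D₀ vD₀≈1 1)) (KP.*-coefficient-1 {w} D₀ w₀≈0))

    -- Evaluating P L E in two orders gives g E = N₀ L. The parts free of x yield `g D₀ = N₀`, and
    -- the coefficients of x yield `g D₁ = - N₀ f`. This applies to arbitrary representations of
    -- both forms, not only to those constructed above.
    riordan-unique : UTX.Unit D → ∀ {g f q N₀ D₀ D₁} →
      RiordanForm P g f → CommonFactorForm N D q N₀ D₀ D₁ →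
      IsQuotient 𝕂⟦t⟧ g N₀ D₀ × IsQuotient 𝕂⟦t⟧ f (T.- D₁) D₀
    riordan-unique D-unit {g} {f} {q} {N₀} {D₀} {D₁}
      riordan@(_ , g₀#0 , _) common@(_ , _ , _ , D₀₀#0 , _) =
      UT.product⇒quotient D₀-unit gD₀≈N₀ , UT.product⇒quotient D₀-unit fD₀≈-D₁
      where
      L E : TX.Carrier
      L = T.1# +x (T.- f)
      E = D₀ +x D₁
      D₀-unit : UT.Unit D₀
      D₀-unit = KP.series-unit (#0⇒unit D₀₀#0)
      gE≈N₀L : (g T.* D₀) +x (g T.* D₁) TX.≈ (N₀ T.* T.1#) +x (N₀ T.* (T.- f))
      gE≈N₀L = begin
        (g T.* D₀) +x (g T.* D₁)              ≈⟨ ⌜⌝-*-+x g D₀ D₁ ⟨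
        ⌜ g ⌝ TX.* E                          ≈⟨ TX.*-congʳ {E} (riordan-product {g} riordan) ⟨
        P TX.* L TX.* E                       ≈⟨ xy∙z≈xz∙y P L E ⟩
        P TX.* E TX.* L                       ≈⟨ TX.*-congʳ {L} (common-factor-product D-unit {q} common) ⟩
        ⌜ N₀ ⌝ TX.* L                         ≈⟨ ⌜⌝-*-+x N₀ T.1# (T.- f) ⟩
        (N₀ T.* T.1#) +x (N₀ T.* (T.- f))     ∎
        where open SetoidReasoning TX.setoid
      gD₀≈N₀ : g T.* D₀ T.≈ N₀
      gD₀≈N₀ = T.trans (+x-injectiveˡ gE≈N₀L) (T.*-identityʳ N₀)
      open SetoidReasoning T.setoid
      -fD₀≈D₁ : T.- f T.* D₀ T.≈ D₁
      -- Replacing `N₀` by `g D₀` in the x-coefficient identity leaves a common factor `g`,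
      -- cancellable because `g 0` is apart from zero.
      -fD₀≈D₁ = UT.unit-cancelʳ (KP.series-unit {g} (#0⇒unit g₀#0)) (begin
        T.- f T.* D₀ T.* g    ≈⟨ T.*-assoc (T.- f) D₀ g ⟩
        T.- f T.* (D₀ T.* g)  ≈⟨ T.*-congˡ {T.- f} (T.trans (T.*-comm D₀ g) gD₀≈N₀) ⟩
        T.- f T.* N₀          ≈⟨ T.*-comm (T.- f) N₀ ⟩
        N₀ T.* T.- f          ≈⟨ +x-injectiveʳ gE≈N₀L ⟨
        g T.* D₁              ≈⟨ T.*-comm g D₁ ⟩
        D₁ T.* g              ∎)
      fD₀≈-D₁ : f T.* D₀ T.≈ T.- D₁
      fD₀≈-D₁ = begin
        f T.* D₀                ≈⟨ TR.-‿involutive (f T.* D₀) ⟨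
        T.- (T.- (f T.* D₀))    ≈⟨ T.-‿cong (TR.-‿distribˡ-* f D₀) ⟩
        T.- (T.- f T.* D₀)      ≈⟨ T.-‿cong -fD₀≈D₁ ⟩
        T.- D₁                  ∎

theorem3p1 :
    ∀ {c ℓ₁ ℓ₂} (K : HeytingField c ℓ₁ ℓ₂) →
    let open BivariateSeries K in
    CharacteristicZero →
    (ℓ : ℕ) → 1 ≤ ℓ →
    (a : ℕ → X.Carrier) → (∀ j → IsPolynomial 𝕂 (a j)) →
    (p : ℕ → X.Carrier) → (∀ n → IsPolynomial 𝕂 (p n)) →
    Recurrence ℓ a p →
    let P : TX.Carrier
        P = p
        N = numerator ℓ a p
        D = denominator ℓ a
    in
    D 0 X.≈ X.1# ×
    IsQuotient 𝕂⟦t,x⟧ P N D ×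
    ((∃[ g ] ∃[ f ] RiordanForm P g f)
      ⇔
     (∃[ q ] ∃[ N₀ ] ∃[ D₀ ] ∃[ D₁ ] CommonFactorForm N D q N₀ D₀ D₁)) ×
    (∀ g f q N₀ D₀ D₁ →
      RiordanForm P g f → CommonFactorForm N D q N₀ D₀ D₁ →
      IsQuotient 𝕂⟦t⟧ g N₀ D₀ × IsQuotient 𝕂⟦t⟧ f (T.- D₁) D₀)
theorem3p1 K _ ℓ 1≤ℓ a _ p _ rec =
  denominator-0 ,
  UTX.product⇒quotient denominator-unit PD≈N ,
  mk⇔ (riordan⇒common-factor K PD≈N) (common-factor⇒riordan K PD≈N denominator-unit) ,
  λ g f q N₀ D₀ D₁ → riordan-unique K PD≈N denominator-unit {g} {f} {q} {N₀} {D₀} {D₁}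
  where
  open BivariateSeries K
  open RecurrenceProperties K ℓ a p
  module UTX = Units 𝕂⟦t,x⟧
  PD≈N = *-denominator rec 1≤ℓ
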